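{- Let $\eta\in(0,1)$. Let $\mathcal{A}$ be a streaming algorithm for attention-based token generation that decides before seeing any data which entries of $QK^T$ to access. Suppose that $\mathcal{A}$, with probability at least $9/10$, outputs for each $i\in[n]$ a $(1\pm\eta)$-approximation $\mathcal{O}_i\in\mathbb{R}^d$ of $Z_i := \operatorname{Attn}(q_i,K_i,V_i)$. Then $\mathcal{A}$ must take $\Omega(nd)$ time to process the last token $(q_n,k_n,v_n)$ in the worst case.
   Context: Setting (attention-based token generation): the input is a stream of $n$ triples $(q_i,k_i,v_i)\in(\mathbb{R}^d)^3$ arriving one at a time; the guarantee of a streaming algorithm must hold for every input stream, the probability being over its own randomness. For each $i$, $K_i$ and $V_i$ are the $i\times d$ matrices whose rows are $k_1^T,\dots,k_i^T$ and $v_1^T,\dots,v_i^T$ respectively; $Q$ and $K$ are the $n\times d$ matrices with rows $q_1^T,\dots,q_n^T$ and $k_1^T,\dots,k_n^T$, so that the $(i,\ell)$ entry of $QK^T$ is the score $q_i^Tk_\ell$. The attention function is $\operatorname{Attn}(q_i,K_i,V_i) := \sum_{\ell=1}^i \frac{e^{q_i^Tk_\ell}}{\sum_{m=1}^i e^{q_i^Tk_m}}\, v_\ell\in\mathbb{R}^d$. A vector $x\in\mathbb{R}^d$ is a $(1\pm\eta)$-approximation of $y\in\mathbb{R}^d$ if $|x_j-y_j|\le\eta\cdot y_j$ for all $j\in[d]$. Non-adaptivity: an algorithm is non-adaptive if the data accesses/queries it performs are pre-decided (either deterministically or through a randomized procedure) before the data arrives. Computational model: when processing the last token, the algorithm is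 viewed as making queries to the softmax distribution $D_n$ over $[n]$ with scores $q_n^Tk_1,\dots,q_n^Tk_n$ (so that $\operatorname{Attn}(q_n,K_n,V_n)=\mathbb{E}_{\ell\sim D_n}[v_\ell]$); each query to an index $\ell$ (access to the entry $q_n^Tk_\ell$) takes time $\Theta(d)$. -}

module Defs where

open import Algebra.Bundles using (CommutativeRing)
open import Data.Bool using (Bool; true; not; T)
open import Data.Fin using (Fin; zero; suc; toℕ; inject≤)
open import Data.Fin.Properties using (toℕ<n)
open import Data.Fin.Subset using (Subset; _∈_; ∣_∣)
open import Data.Nat as ℕ using (ℕ; zero; suc)
open import Data.Product using (∃-syntax; _×_; proj₁)
open import Data.Sum using (_⊎_)
open import Data.Vec using (lookup)
open import Data.Vec.Functional using (Vector; tail)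
open import Function using (_∘_; _⇔_)
open import Level using (0ℓ)
open import Relation.Binary using (Rel; IsStrictPartialOrder)
open import Relation.Binary.PropositionalEquality using (_≡_; _≢_; _≗_)
open import Relation.Nullary using (¬_)
import Algebra.Properties.Semiring.Sum
import Algebra.Definitions.RawMonoid

-- The standard library has no real numbers, so they are axiomatised: a
-- Cauchy-complete Archimedean ordered field, together with the exponential
-- function. The order axioms are the constructive ones (cotransitivity and
-- tightness instead of trichotomy); classically these axioms characterise ℝ up
-- to isomorphism.
record RealNumbers : Set₁ where
  field
    commutativeRing : CommutativeRing 0ℓ 0ℓ

  open CommutativeRing commutativeRing public
    renaming (Carrier to ℝ) hiding (zero)
  open Algebra.Properties.Semiring.Sum semiring public using (sum)

  infix 4 _<_ _≤_

  field
    _<_                  : Rel ℝ 0ℓ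
    isStrictPartialOrder : IsStrictPartialOrder _≈_ _<_
    <-cotrans            : ∀ {x y} → x < y → ∀ z → (x < z) ⊎ (z < y)
    <-tight              : ∀ {x y} → ¬ (x < y) → ¬ (y < x) → x ≈ y
    0<1                  : 0# < 1#
    +-monoˡ-<            : ∀ {x y} z → x < y → x + z < y + z
    *-pos                : ∀ {x y} → 0# < x → 0# < y → 0# < x * y
    -- Negative numbers are inverted through x⁻¹ = - (- x)⁻¹.
    inverse              : ∀ {x} → 0# < x → ∃[ y ] x * y ≈ 1#

  _≤_ : Rel ℝ 0ℓ
  x ≤ y = ¬ (y < x)

  fromℕ : ℕ → ℝ
  fromℕ n = Algebra.Definitions.RawMonoid._×_ +-rawMonoid n 1#

  -- | x - y | < ε
  Within : ℝ → ℝ → ℝ → Set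
  Within ε x y = (x - y < ε) × (y - x < ε)

  Cauchy : (ℕ → ℝ) → Set
  Cauchy f = ∀ ε → 0# < ε → ∃[ N ] ∀ m n → N ℕ.≤ m → N ℕ.≤ n → Within ε (f m) (f n)

  Converges : (ℕ → ℝ) → ℝ → Set
  Converges f l = ∀ ε → 0# < ε → ∃[ N ] ∀ n → N ℕ.≤ n → Within ε (f n) l

  field
    archimedean : ∀ x → ∃[ n ] x < fromℕ n
    complete    : ∀ f → Cauchy f → ∃[ l ] Converges f l

    -- The homomorphism law and the bound 1 + x ≤ exp x determine the map
    -- x ↦ eˣ uniquely.
    exp      : ℝ → ℝ
    exp-cong : ∀ {x y} → x ≈ y → exp x ≈ exp y
    exp-pos  : ∀ x → 0# < exp x
    exp-+    : ∀ x y → exp (x + y) ≈ exp x * exp y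
    1+x≤exp  : ∀ x → 1# + x ≤ exp x

  open IsStrictPartialOrder isStrictPartialOrder public
    using (<-resp-≈; <-respˡ-≈; <-respʳ-≈)
    renaming (trans to <-trans; irrefl to <-irrefl)

  divide : ℝ → (y : ℝ) → 0# < y → ℝ
  divide x y 0<y = x * proj₁ (inverse 0<y)

  +-pos : ∀ {x y} → 0# < x → 0# < y → 0# < x + y
  +-pos {x} {y} 0<x 0<y = <-trans 0<y (<-respˡ-≈ (+-identityˡ y) (+-monoˡ-< y 0<x))

  sum-pos : ∀ {m} (f : Vector ℝ (suc m)) → (∀ i → 0# < f i) → 0# < sum f
  sum-pos {zero}  f p = <-respʳ-≈ (sym (+-identityʳ (f zero))) (p zero)
  sum-pos {suc m} f p = +-pos (p zero) (sum-pos (tail f) (p ∘ suc))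

  fromℕ-pos : ∀ m → 0# < fromℕ (suc m)
  fromℕ-pos zero    = <-respʳ-≈ (sym (+-identityʳ 1#)) 0<1
  fromℕ-pos (suc m) = +-pos 0<1 (fromℕ-pos m)

module _ (ℛ : RealNumbers) where
  open RealNumbers ℛ

  -- Events are Boolean-valued: an event either occurs or does not.
  record ProbabilitySpace : Set₁ where
    field
      Ω          : Set
      Measurable : (Ω → Bool) → Set
      -- Total for convenience; only the values at measurable events matter.
      P          : (Ω → Bool) → ℝ

    Disjoint : (ℕ → Ω → Bool) → Set
    Disjoint A = ∀ i j ω → i ≢ j → T (A i ω) → ¬ T (A j ω)

    IsUnion : (Ω → Bool) → (ℕ → Ω → Bool) → Set
    IsUnion B A = ∀ ω → T (B ω) ⇔ (∃[ i ] T (A i ω))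

    field
      full-measurable       : Measurable (λ _ → true)
      complement-measurable : ∀ {A} → Measurable A → Measurable (not ∘ A)
      union-measurable      : ∀ {A B} → (∀ i → Measurable (A i)) → IsUnion B A → Measurable B
      P-cong     : ∀ {A B} → Measurable A → Measurable B → A ≗ B → P A ≈ P B
      P-nonneg   : ∀ {A} → Measurable A → 0# ≤ P A
      P-full     : P (λ _ → true) ≈ 1#
      P-additive : ∀ {A B} → (∀ i → Measurable (A i)) → Disjoint A → IsUnion B A →
                   Converges (λ N → sum {N} (λ i → P (A (toℕ i)))) (P B)

    -- X holds with probability at least p. Real inequalities are undecidable,
    -- so X itself need not be an event; it has to contain one of probability ≥ p.
    HoldsWithProbability≥ : ℝ → (Ω → Set) → Set
    HoldsWithProbability≥ p X =
      ∃[ A ] Measurable A × (p ≤ P A) × (∀ ω → T (A ω) → X ω)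

    AlmostSurely : (Ω → Set) → Set
    AlmostSurely = HoldsWithProbability≥ 1#

  nine-tenths : ℝ
  nine-tenths = divide (fromℕ 9) (fromℕ 10) (fromℕ-pos 9)

  _∙_ : ∀ {d} → Vector ℝ d → Vector ℝ d → ℝ
  x ∙ y = sum (λ j → x j * y j)

  -- Row ℓ of K and V is K ℓ and V ℓ. There is at least one row, so the
  -- normalising sum is positive.
  Attn : ∀ {m d} → Vector ℝ d → (K V : Fin (suc m) → Vector ℝ d) → Vector ℝ d
  Attn q K V j = sum (λ ℓ → divide (exp (q ∙ K ℓ)) (sum weight) weight-sum-pos * V ℓ j)
    where
    weight = λ m → exp (q ∙ K m)
    weight-sum-pos = sum-pos weight (λ m → exp-pos (q ∙ K m))

  record Stream (n d : ℕ) : Set where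
    field
      q k v : Fin n → Vector ℝ d

    -- The entries of QKᵀ.
    score : Fin n → Fin n → ℝ
    score a ℓ = q a ∙ k ℓ

  -- The rows with indices 0, …, i, i.e. the matrix Kᵢ or Vᵢ when the tokens
  -- are numbered from 0.
  prefix : ∀ {n} {A : Set} (i : Fin n) → (Fin n → A) → Fin (suc (toℕ i)) → A
  prefix i M ℓ = M (inject≤ ℓ (toℕ<n i))

  Target : ∀ {n d} → Stream n d → Fin n → Vector ℝ d
  Target σ i = Attn (q i) (prefix i k) (prefix i v)
    where open Stream σ

  -- | xⱼ - yⱼ | ≤ η yⱼ for all j
  Approximates : ∀ {d} → ℝ → Vector ℝ d → Vector ℝ d → Set
  Approximates η x y = ∀ j → (x j - y j ≤ η * y j) × (y j - x j ≤ η * y j)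

  -- No vector approximates y in the above sense when some yⱼ is negative, so
  -- outputs can only be required on streams with nonnegative targets.
  Admissible : ∀ {n d} → Stream n d → Set
  Admissible σ = ∀ i j → 0# ≤ Target σ i j

  -- A randomised algorithm for n tokens in dimension d that fixes its accesses
  -- before the data arrives; queryTime d is the time of one access to an entry
  -- of QKᵀ.
  record NonAdaptiveAlgorithm (queryTime : ℕ → ℕ) (n d : ℕ) : Set₁ where
    field
      randomness : ProbabilitySpace

    open ProbabilitySpace randomness public

    field
      -- ℓ ∈ accesses ω a: the entry (a , ℓ) of QKᵀ is accessed. The set depends
      -- on the random seed ω only, not on the stream.
      accesses            : Ω → Fin n → Subset n
      accesses-measurable : ∀ a ℓ → Measurable (λ ω → lookup (accesses ω a) ℓ)

      output : Ω → Stream n d → Fin n → Vector ℝ d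

      -- The i-th output is determined by the seed, the queries and values of
      -- tokens 0, …, i, and the accessed entries among those tokens. Keys
      -- influence it through accessed entries only.
      output-local : ∀ ω (i : Fin n) (σ σ′ : Stream n d) →
        let open Stream in
        (∀ a → toℕ a ℕ.≤ toℕ i → ∀ j → q σ a j ≈ q σ′ a j) →
        (∀ a → toℕ a ℕ.≤ toℕ i → ∀ j → v σ a j ≈ v σ′ a j) →
        (∀ a ℓ → toℕ a ℕ.≤ toℕ i → toℕ ℓ ℕ.≤ toℕ i →
           ℓ ∈ accesses ω a → score σ a ℓ ≈ score σ′ a ℓ) →
        ∀ j → output ω σ i j ≈ output ω σ′ i j

      -- Time spent on the last token. Entries in the last row of QKᵀ exist only
      -- once the last query has arrived, so all accesses to them happen then;
      -- any further work may be added on top.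
      lastTokenTime : Ω → Stream n d → ℕ
      access-time   : ∀ ω σ (last : Fin n) → suc (toℕ last) ≡ n →
        ∣ accesses ω last ∣ ℕ.* queryTime d ℕ.≤ lastTokenTime ω σ

    OutputsApproximations : ℝ → Set
    OutputsApproximations η = ∀ σ → Admissible σ →
      HoldsWithProbability≥ nine-tenths
        (λ ω → ∀ i → Approximates η (output ω σ i) (Target σ i))

    -- t is an upper bound for the worst-case time of the last token.
    LastTokenTimeBound : ℕ → Set
    LastTokenTimeBound t = ∀ σ → AlmostSurely (λ ω → lastTokenTime ω σ ℕ.≤ t)

-- τ d = Θ(d); an integer factor a stands for the lower constant 1 / a.
Θ-linear : (ℕ → ℕ) → Set
Θ-linear τ = ∃[ a ] ∃[ b ] ∀ d → 1 ℕ.≤ d → (d ℕ.≤ a ℕ.* τ d) × (τ d ℕ.≤ b ℕ.* d)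

{-# OPTIONS --safe #-}
module Submission where

-- Let n = m + 1. For every token ℓ other than the first there are two streams
-- whose scores differ in a single entry of Q Kᵀ, the one of the last query with
-- the key of ℓ. The first value is +1, the value of ℓ is -1 and all others are 0.
-- In one stream all scores are 0, so the two values cancel and the last target
-- is exactly 0; in the other the score of ℓ is -1, which makes the last target
-- positive. An approximation of 0 with relative error is at most 0, and for η < 1
-- an approximation of a positive number is positive. Hence a seed that is
-- accurate on both streams must access the distinguishing entry
-- (accurate⇒accessed), and by a union bound this happens with probability at
-- least 8/10 (access-probability).
--
-- Because the accesses do not depend on the stream, this holds for all m entries
-- of the last row simultaneously, under one distribution. If at most s entries
-- of that row are accessed almost surely, then the expected number of accesses
-- lies between m / 2 and s (expected-count-bound, number-of-accesses). With
-- s = t / τ and τ = Ω(d) for the time τ of an access, t = Ω(n d) follows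
-- (time-bound).
--
-- The order of the reals is only cotransitive and tight, and x ≤ y means
-- ¬ (y < x), so inequalities are proved without deciding signs. The targets are
-- compared after multiplication by the softmax denominator.

open import Defs
open import Data.Bool using (Bool; true; false; T; T?; _∧_; not; if_then_else_)
open import Data.Bool.Properties using (T-∧; ∧-comm; not-involutive)
open import Data.Empty using (⊥)
open import Data.Fin as Fin using (Fin; zero; suc; toℕ; inject≤)
open import Data.Fin.Properties
  using (toℕ<n; toℕ-fromℕ; toℕ-fromℕ<; toℕ-injective; toℕ-inject≤; inject≤-injective; suc-injective)
  renaming (_≟_ to _≟ᶠ_)
open import Data.Fin.Subset using (Subset; ∣_∣)
open import Data.Nat as ℕ using (ℕ; zero; suc; s≤s; s≤s⁻¹)
import Data.Nat.DivMod as ℕ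
import Data.Nat.Properties as ℕ
open import Data.Product using (∃-syntax; _×_; _,_; proj₁; proj₂)
open import Data.Sum using (_⊎_; inj₁; inj₂)
open import Data.Unit using (tt)
open import Data.Vec using (_∷_; lookup; tabulate)
open import Data.Vec.Properties using (tabulate∘lookup; []=⇒lookup)
open import Data.Vec.Functional using (Vector)
open import Function using (_∘_; _⇔_; mk⇔; Equivalence; Injective)
open import Relation.Binary using (IsPreorder)
open import Relation.Binary.PropositionalEquality as ≡ using (_≡_; _≢_)
open import Relation.Nullary using (¬_; Dec; yes; no; does; contradiction)
open import Relation.Nullary.Decidable using (dec-true; dec-false)
import Algebra.Properties.AbelianGroup
import Algebra.Properties.CommutativeMonoid.Mult
import Algebra.Properties.Ring
import Algebra.Properties.Semiring.Mult
import Algebra.Properties.Semiring.Sum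
import Relation.Binary.Reasoning.Base.Triple

-- Ordered-field arithmetic

module OrderedField (ℛ : RealNumbers) where
  open RealNumbers ℛ hiding (sum)
  open Algebra.Properties.Ring ring public
    using (-‿distribʳ-*; -0#≈0#; [y-z]x≈yx-zx)
  open Algebra.Properties.AbelianGroup +-abelianGroup public
    using (xyx⁻¹≈y)
    renaming (//-rightDividesˡ to x-y+y≈x; //-rightDividesʳ to x+y-y≈x)
  open Algebra.Properties.CommutativeMonoid.Mult +-commutativeMonoid public
    using (×-homo-+; ×-distrib-+; ×-congʳ)
    renaming (_×_ to _·_)
  open Algebra.Properties.Semiring.Mult semiring public using (×-assoc-*)
  open Algebra.Properties.Semiring.Sum semiring public
    using (sum; sum-cong-≋; sum-replicate; sum-replicate-zero; ∑-distrib-+)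

  <-asym : ∀ {x y} → x < y → ¬ (y < x)
  <-asym x<y y<x = <-irrefl refl (<-trans x<y y<x)

  <⇒≤ : ∀ {x y} → x < y → x ≤ y
  <⇒≤ = <-asym

  ≤-reflexive : ∀ {x y} → x ≈ y → x ≤ y
  ≤-reflexive x≈y = <-irrefl (sym x≈y)

  ≤-refl : ∀ {x} → x ≤ x
  ≤-refl = ≤-reflexive refl

  <-≤-trans : ∀ {x y z} → x < y → y ≤ z → x < z
  <-≤-trans {z = z} x<y y≤z with <-cotrans x<y z
  ... | inj₁ x<z = x<z
  ... | inj₂ z<y = contradiction z<y y≤z

  ≤-<-trans : ∀ {x y z} → x ≤ y → y < z → x < z
  ≤-<-trans {x} x≤y y<z with <-cotrans y<z x
  ... | inj₁ y<x = contradiction y<x x≤y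
  ... | inj₂ x<z = x<z

  ≤-trans : ∀ {x y z} → x ≤ y → y ≤ z → x ≤ z
  ≤-trans x≤y y≤z z<x = y≤z (<-≤-trans z<x x≤y)

  ≤-isPreorder : IsPreorder _≈_ _≤_
  ≤-isPreorder = record
    { isEquivalence = isEquivalence ; reflexive = ≤-reflexive ; trans = ≤-trans }

  module ≤-Reasoning = Relation.Binary.Reasoning.Base.Triple
    ≤-isPreorder <-asym <-trans <-resp-≈ <⇒≤ <-≤-trans ≤-<-trans

  open ≤-Reasoning

  +-cancelʳ-< : ∀ {x y} z → x + z < y + z → x < y
  +-cancelʳ-< {x} {y} z x+z<y+z = begin-strict
    x            ≈⟨ x+y-y≈x z x ⟨
    x + z - z    <⟨ +-monoˡ-< (- z) x+z<y+z ⟩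
    y + z - z    ≈⟨ x+y-y≈x z y ⟩
    y            ∎

  +-monoˡ-≤ : ∀ {x y} z → x ≤ y → x + z ≤ y + z
  +-monoˡ-≤ z x≤y y+z<x+z = x≤y (+-cancelʳ-< z y+z<x+z)

  +-monoʳ-≤ : ∀ {x y} z → x ≤ y → z + x ≤ z + y
  +-monoʳ-≤ {x} {y} z x≤y = begin
    z + x  ≈⟨ +-comm z x ⟩
    x + z  ≤⟨ +-monoˡ-≤ z x≤y ⟩
    y + z  ≈⟨ +-comm y z ⟩
    z + y  ∎

  +-mono-≤ : ∀ {x y u v} → x ≤ y → u ≤ v → x + u ≤ y + v
  +-mono-≤ {y = y} {u = u} x≤y u≤v = ≤-trans (+-monoˡ-≤ u x≤y) (+-monoʳ-≤ y u≤v)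

  +-cancelʳ-≤ : ∀ {x y} z → x + z ≤ y + z → x ≤ y
  +-cancelʳ-≤ z x+z≤y+z y<x = x+z≤y+z (+-monoˡ-< z y<x)

  x<y⇒0<y-x : ∀ {x y} → x < y → 0# < y - x
  x<y⇒0<y-x {x} {y} x<y = begin-strict
    0#     ≈⟨ -‿inverseʳ x ⟨
    x - x  <⟨ +-monoˡ-< (- x) x<y ⟩
    y - x  ∎

  x≤y⇒0≤y-x : ∀ {x y} → x ≤ y → 0# ≤ y - x
  x≤y⇒0≤y-x {x} {y} x≤y = begin
    0#     ≈⟨ -‿inverseʳ x ⟨
    x - x  ≤⟨ +-monoˡ-≤ (- x) x≤y ⟩
    y - x  ∎

  0≤y-x⇒x≤y : ∀ {x y} → 0# ≤ y - x → x ≤ y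
  0≤y-x⇒x≤y {x} {y} 0≤y-x = begin
    x          ≈⟨ +-identityˡ x ⟨
    0# + x     ≤⟨ +-monoˡ-≤ x 0≤y-x ⟩
    y - x + x  ≈⟨ x-y+y≈x x y ⟩
    y          ∎

  -- By tightness: a factor that is nonnegative and not positive is 0, and either
  -- factor being 0 contradicts a negative product.
  *-nonneg : ∀ {x y} → 0# ≤ x → 0# ≤ y → 0# ≤ x * y
  *-nonneg {x} {y} 0≤x 0≤y xy<0 = x≉0 (sym (<-tight 0≮x 0≤x))
    where
    x≉0 : ¬ (x ≈ 0#)
    x≉0 x≈0 = <-irrefl (trans (*-congʳ x≈0) (zeroˡ y)) xy<0
    y≉0 : ¬ (y ≈ 0#)
    y≉0 y≈0 = <-irrefl (trans (*-congˡ y≈0) (zeroʳ x)) xy<0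
    0≮x : ¬ (0# < x)
    0≮x 0<x = y≉0 (sym (<-tight (λ 0<y → <-asym xy<0 (*-pos 0<x 0<y)) 0≤y))

  *-monoˡ-≤ : ∀ {x y z} → 0# ≤ z → x ≤ y → x * z ≤ y * z
  *-monoˡ-≤ {x} {y} {z} 0≤z x≤y = 0≤y-x⇒x≤y (begin
    0#             ≤⟨ *-nonneg (x≤y⇒0≤y-x x≤y) 0≤z ⟩
    (y - x) * z    ≈⟨ [y-z]x≈yx-zx z y x ⟩
    y * z - x * z  ∎)

  *-monoˡ-< : ∀ {x y z} → 0# < z → x < y → x * z < y * z
  *-monoˡ-< {x} {y} {z} 0<z x<y = begin-strict
    x * z                    ≈⟨ +-identityˡ (x * z) ⟨
    0# + x * z               <⟨ +-monoˡ-< (x * z) (*-pos (x<y⇒0<y-x x<y) 0<z) ⟩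
    (y - x) * z + x * z      ≈⟨ +-congʳ ([y-z]x≈yx-zx z y x) ⟩
    y * z - x * z + x * z    ≈⟨ x-y+y≈x (x * z) (y * z) ⟩
    y * z                    ∎

  reciprocal-nonneg : ∀ {w r} → 0# < w → w * r ≈ 1# → 0# ≤ r
  reciprocal-nonneg {w} {r} 0<w wr≈1 r<0 = <-asym 0<1 (begin-strict
    1#      ≈⟨ wr≈1 ⟨
    w * r   ≈⟨ *-comm w r ⟩
    r * w   <⟨ *-monoˡ-< 0<w r<0 ⟩
    0# * w  ≈⟨ zeroˡ w ⟩
    0#      ∎)

  exp-mono-< : ∀ {x y} → x < y → exp x < exp y
  exp-mono-< {x} {y} x<y = begin-strict
    exp x                ≈⟨ *-identityˡ (exp x) ⟨
    1# * exp x           <⟨ *-monoˡ-< (exp-pos x) 1<exp[y-x] ⟩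
    exp (y - x) * exp x  ≈⟨ exp-+ (y - x) x ⟨
    exp (y - x + x)      ≈⟨ exp-cong (x-y+y≈x x y) ⟩
    exp y                ∎
    where
    1<exp[y-x] : 1# < exp (y - x)
    1<exp[y-x] = begin-strict
      1#            ≈⟨ +-identityˡ 1# ⟨
      0# + 1#       <⟨ +-monoˡ-< 1# (x<y⇒0<y-x x<y) ⟩
      y - x + 1#    ≈⟨ +-comm (y - x) 1# ⟩
      1# + (y - x)  ≤⟨ 1+x≤exp (y - x) ⟩
      exp (y - x)   ∎

  exp-mono-≤ : ∀ {x y} → x ≤ y → exp x ≤ exp y
  exp-mono-≤ {x} {y} x≤y ey<ex = <-irrefl (exp-cong y≈x) ey<ex
    where
    y≈x : y ≈ x
    y≈x = <-tight x≤y (λ x<y → <-asym ey<ex (exp-mono-< x<y))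

  -- n · x is the n-fold sum of x, so fromℕ n is n · 1.
  ·-mono-≤ : ∀ n {x y} → x ≤ y → n · x ≤ n · y
  ·-mono-≤ zero    x≤y = ≤-refl
  ·-mono-≤ (suc n) x≤y = +-mono-≤ x≤y (·-mono-≤ n x≤y)

  ·-nonneg : ∀ n {x} → 0# ≤ x → 0# ≤ n · x
  ·-nonneg zero        0≤x = ≤-refl
  ·-nonneg (suc n) {x} 0≤x = begin
    0#         ≈⟨ +-identityˡ 0# ⟨
    0# + 0#    ≤⟨ +-mono-≤ 0≤x (·-nonneg n 0≤x) ⟩
    x + n · x  ∎

  fromℕ-cancel-≤ : ∀ {m n} → fromℕ m ≤ fromℕ n → m ℕ.≤ n
  fromℕ-cancel-≤ {m} {n} le with m ℕ.≤? n
  ... | yes m≤n = m≤n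
  ... | no  m≰n = contradiction fromℕ-n<fromℕ-m le
    where
    k = m ℕ.∸ suc n
    m≡k+1+n : suc k ℕ.+ n ≡ m
    m≡k+1+n = ≡.trans (≡.sym (ℕ.+-suc k n)) (ℕ.m∸n+n≡m (ℕ.≰⇒> m≰n))
    fromℕ-n<fromℕ-m : fromℕ n < fromℕ m
    fromℕ-n<fromℕ-m = begin-strict
      fromℕ n                  ≈⟨ +-identityˡ (fromℕ n) ⟨
      0# + fromℕ n             <⟨ +-monoˡ-< (fromℕ n) (fromℕ-pos k) ⟩
      fromℕ (suc k) + fromℕ n  ≈⟨ ×-homo-+ 1# (suc k) n ⟨
      fromℕ (suc k ℕ.+ n)      ≈⟨ reflexive (≡.cong fromℕ m≡k+1+n) ⟩
      fromℕ m                  ∎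

  sum-mono-≤ : ∀ {n} {f g : Vector ℝ n} → (∀ i → f i ≤ g i) → sum f ≤ sum g
  sum-mono-≤ {zero}  f≤g = ≤-refl
  sum-mono-≤ {suc n} f≤g = +-mono-≤ (f≤g zero) (sum-mono-≤ (f≤g ∘ suc))

  sum-zero : ∀ {n} {f : Vector ℝ n} → (∀ i → f i ≈ 0#) → sum f ≈ 0#
  sum-zero {n} f≈0 = trans (sum-cong-≋ f≈0) (sum-replicate-zero n)

  limit-of-eventually-constant : ∀ {f l} N₀ c → (∀ n → N₀ ℕ.≤ n → f n ≈ c) →
    Converges f l → l ≈ c
  limit-of-eventually-constant {f} {l} N₀ c f≈c f→l = <-tight l≮c c≮l
    where
    l≮c : ¬ (l < c)
    l≮c l<c =
      let N , close = f→l (c - l) (x<y⇒0<y-x l<c)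
          n         = N ℕ.⊔ N₀
      in <-irrefl (+-congʳ (f≈c n (ℕ.m≤n⊔m N N₀))) (proj₁ (close n (ℕ.m≤m⊔n N N₀)))
    c≮l : ¬ (c < l)
    c≮l c<l =
      let N , close = f→l (l - c) (x<y⇒0<y-x c<l)
          n         = N ℕ.⊔ N₀
      in <-irrefl (+-congˡ (-‿cong (f≈c n (ℕ.m≤n⊔m N N₀)))) (proj₂ (close n (ℕ.m≤m⊔n N N₀)))

-- Finite probability

module Probability (ℛ : RealNumbers) (𝒫 : ProbabilitySpace ℛ) where
  open RealNumbers ℛ hiding (sum)
  open OrderedField ℛ
  open ≤-Reasoning
  open ProbabilitySpace 𝒫

  Event : Set
  Event = Ω → Bool

  infixl 7 _∩_

  ∅ : Event
  ∅ _ = false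

  _∩_ : Event → Event → Event
  (A ∩ B) ω = A ω ∧ B ω

  ∁ : Event → Event
  ∁ A = not ∘ A

  ∅-measurable : Measurable ∅
  ∅-measurable = complement-measurable full-measurable

  -- The sequence A, B, ∅, ∅, …
  pair : Event → Event → ℕ → Event
  pair A B zero          = A
  pair A B (suc zero)    = B
  pair A B (suc (suc _)) = ∅

  pair-measurable : ∀ {A B} → Measurable A → Measurable B → ∀ i → Measurable (pair A B i)
  pair-measurable a b zero          = a
  pair-measurable a b (suc zero)    = b
  pair-measurable a b (suc (suc _)) = ∅-measurable

  pair-union : ∀ {A B C} → (∀ ω → T (C ω) ⇔ (T (A ω) ⊎ T (B ω))) → IsUnion C (pair A B)
  pair-union {A} {B} {C} C⇔A∪B ω =
    mk⇔ (occurring ∘ Equivalence.to (C⇔A∪B ω)) (Equivalence.from (C⇔A∪B ω) ∘ which)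
    where
    occurring : T (A ω) ⊎ T (B ω) → ∃[ i ] T (pair A B i ω)
    occurring (inj₁ a) = 0 , a
    occurring (inj₂ b) = 1 , b
    which : ∃[ i ] T (pair A B i ω) → T (A ω) ⊎ T (B ω)
    which (zero     , a) = inj₁ a
    which (suc zero , b) = inj₂ b

  ∩-measurable : ∀ {A B} → Measurable A → Measurable B → Measurable (A ∩ B)
  ∩-measurable {A} {B} a b =
    -- A union of a constant sequence of events, to pass from the double
    -- complement of A ∩ B to A ∩ B itself.
    union-measurable (λ _ → complement-measurable ∁[A∩B]-measurable)
      (λ ω → mk⇔ (λ t → 0 , ≡.subst T (≡.sym (not-involutive (A ω ∧ B ω))) t)
                 (λ (_ , t) → ≡.subst T (not-involutive (A ω ∧ B ω)) t))
    where
    de-morgan : ∀ x y → T (not (x ∧ y)) ⇔ (T (not x) ⊎ T (not y))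
    de-morgan true  y = mk⇔ inj₂ λ { (inj₁ ()) ; (inj₂ t) → t }
    de-morgan false y = mk⇔ inj₁ (λ _ → tt)
    ∁[A∩B]-measurable : Measurable (∁ (A ∩ B))
    ∁[A∩B]-measurable = union-measurable
      (pair-measurable (complement-measurable a) (complement-measurable b))
      (pair-union (λ ω → de-morgan (A ω) (B ω)))

  -- Partial sums of the constant sequence ∅, ∅, … converge to P ∅, so they
  -- cannot exceed 2 P ∅, which they would if P ∅ were positive.
  P-∅ : P ∅ ≈ 0#
  P-∅ = sym (<-tight P∅≮0 (P-nonneg ∅-measurable))
    where
    p = P ∅
    P∅≮0 : ¬ (0# < p)
    P∅≮0 0<p = <-irrefl refl (begin-strict
      p                        ≈⟨ +-identityʳ p ⟨
      p + 0#                   ≤⟨ +-monoʳ-≤ p tail-nonneg ⟩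
      p + sum {N} (λ _ → p)    ≈⟨ xyx⁻¹≈y p (p + sum {N} (λ _ → p)) ⟨
      p + (p + sum {N} (λ _ → p)) - p  <⟨ proj₁ (proj₂ limit (suc (suc N)) (ℕ.m≤n+m N 2)) ⟩
      p                        ∎)
      where
      limit : ∃[ N ] ∀ n → N ℕ.≤ n → Within p (sum {n} (λ _ → p)) p
      limit = P-additive (λ _ → ∅-measurable) (λ _ _ _ _ ()) (λ _ → mk⇔ (λ ()) (λ ())) p 0<p
      N = proj₁ limit
      tail-nonneg : 0# ≤ sum {N} (λ _ → p)
      tail-nonneg = begin
        0#                 ≤⟨ ·-nonneg N (<⇒≤ 0<p) ⟩
        N · p              ≈⟨ sum-replicate N ⟨
        sum {N} (λ _ → p)  ∎

  P-disjoint-union : ∀ {A B C} → Measurable A → Measurable B →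
    (∀ ω → T (A ω) → ¬ T (B ω)) → (∀ ω → T (C ω) ⇔ (T (A ω) ⊎ T (B ω))) →
    P C ≈ P A + P B
  P-disjoint-union {A} {B} {C} a b A∩B≡∅ C⇔A∪B =
    limit-of-eventually-constant 2 (P A + P B) partial-sums
      (P-additive (pair-measurable a b) disjoint (pair-union C⇔A∪B))
    where
    disjoint : Disjoint (pair A B)
    disjoint zero          zero          _ 0≢0 _  = contradiction ≡.refl 0≢0
    disjoint zero          (suc zero)    ω _   ta = A∩B≡∅ ω ta
    disjoint zero          (suc (suc _)) _ _   _  ()
    disjoint (suc zero)    zero          ω _   tb ta = A∩B≡∅ ω ta tb
    disjoint (suc zero)    (suc zero)    _ 1≢1 _  = contradiction ≡.refl 1≢1
    disjoint (suc zero)    (suc (suc _)) _ _   _  ()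
    disjoint (suc (suc _)) _             _ _   ()
    partial-sums : ∀ n → 2 ℕ.≤ n → sum {n} (λ i → P (pair A B (toℕ i))) ≈ P A + P B
    partial-sums (suc (suc n)) _ =
      +-congˡ (trans (+-congˡ (sum-zero {n} (λ _ → P-∅))) (+-identityʳ (P B)))
    partial-sums (suc zero) (s≤s ())

  P-split : ∀ {F} G → Measurable F → Measurable G → P F ≈ P (F ∩ G) + P (F ∩ ∁ G)
  P-split {F} G f g =
    P-disjoint-union (∩-measurable f g) (∩-measurable f (complement-measurable g))
      (λ ω → exclusive (F ω) (G ω)) (λ ω → cases (F ω) (G ω))
    where
    exclusive : ∀ x y → T (x ∧ y) → ¬ T (x ∧ not y)
    exclusive true true _ ()
    cases : ∀ x y → T x ⇔ (T (x ∧ y) ⊎ T (x ∧ not y))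
    cases true  true  = mk⇔ inj₁ (λ _ → tt)
    cases true  false = mk⇔ inj₂ (λ _ → tt)
    cases false _     = mk⇔ (λ ()) λ { (inj₁ ()) ; (inj₂ ()) }

  P-mono : ∀ {A B} → Measurable A → Measurable B → (∀ ω → T (A ω) → T (B ω)) → P A ≤ P B
  P-mono {A} {B} a b A⊆B = begin
    P A                      ≈⟨ P-cong a (∩-measurable b a) (λ ω → absorb (A ω) (B ω) (A⊆B ω)) ⟩
    P (B ∩ A)                ≈⟨ +-identityʳ (P (B ∩ A)) ⟨
    P (B ∩ A) + 0#           ≤⟨ +-monoʳ-≤ _ (P-nonneg (∩-measurable b (complement-measurable a))) ⟩
    P (B ∩ A) + P (B ∩ ∁ A)  ≈⟨ P-split A b a ⟨
    P B                      ∎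
    where
    absorb : ∀ x y → (T x → T y) → x ≡ y ∧ x
    absorb true  true  _   = ≡.refl
    absorb true  false x⇒y = contradiction tt x⇒y
    absorb false true  _   = ≡.refl
    absorb false false _   = ≡.refl

  P≤1 : ∀ {A} → Measurable A → P A ≤ 1#
  P≤1 a = ≤-trans (P-mono a full-measurable (λ _ _ → tt)) (≤-reflexive P-full)

  P-∩-lower-bound : ∀ {A B} → Measurable A → Measurable B → P A + P B ≤ P (A ∩ B) + 1#
  P-∩-lower-bound {A} {B} a b = begin
    P A + P B                        ≈⟨ +-congʳ (P-split B a b) ⟩
    P (A ∩ B) + P (A ∩ ∁ B) + P B    ≈⟨ +-assoc _ _ _ ⟩
    P (A ∩ B) + (P (A ∩ ∁ B) + P B)  ≤⟨ +-monoʳ-≤ _ at-most-1 ⟩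
    P (A ∩ B) + 1#                   ∎
    where
    ∁b = complement-measurable b
    at-most-1 : P (A ∩ ∁ B) + P B ≤ 1#
    at-most-1 = begin
      P (A ∩ ∁ B) + P B  ≤⟨ +-monoˡ-≤ (P B) (P-mono (∩-measurable a ∁b) ∁b
                              (λ ω → proj₂ ∘ Equivalence.to (T-∧ {A ω}))) ⟩
      P (∁ B) + P B      ≈⟨ +-comm _ _ ⟩
      P B + P (∁ B)      ≈⟨ P-split {λ _ → true} B full-measurable b ⟨
      P (λ _ → true)     ≈⟨ P-full ⟩
      1#                 ∎

  -- Double counting, E[#{i : Gᵢ} · 1_F] ≤ s P(F) when at most s of the Gᵢ occur
  -- on F. Induction on the number of events: F is split along the first one, and
  -- on the part inside it only s - 1 others can occur.
  expected-count-bound : ∀ {m} (G : Fin m → Event) (F : Event) s →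
    (∀ i → Measurable (G i)) → Measurable F →
    (∀ ω → T (F ω) → ∣ tabulate (λ i → G i ω) ∣ ℕ.≤ s) →
    sum (λ i → P (F ∩ G i)) ≤ s · P F
  expected-count-bound {zero}  G F s g f count≤s = ·-nonneg s (P-nonneg f)
  expected-count-bound {suc m} G F s g f count≤s = begin
    P F₁ + sum (λ i → P (F ∩ G (suc i)))
      ≈⟨ +-congˡ (trans (sum-cong-≋ split-each) (∑-distrib-+ (λ i → P (F₁ ∩ G (suc i))) _)) ⟩
    P F₁ + (sum (λ i → P (F₁ ∩ G (suc i))) + sum (λ i → P (F₀ ∩ G (suc i))))
      ≈⟨ +-assoc _ _ _ ⟨
    P F₁ + sum (λ i → P (F₁ ∩ G (suc i))) + sum (λ i → P (F₀ ∩ G (suc i)))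
      ≤⟨ +-mono-≤ (inside s count-inside) (expected-count-bound (G ∘ suc) F₀ s (g ∘ suc) f₀ count-outside) ⟩
    s · P F₁ + s · P F₀
      ≈⟨ ×-distrib-+ (P F₁) (P F₀) s ⟨
    s · (P F₁ + P F₀)
      ≈⟨ ×-congʳ s (P-split (G zero) f (g zero)) ⟨
    s · P F ∎
    where
    F₁ = F ∩ G zero
    F₀ = F ∩ ∁ (G zero)
    f₁ = ∩-measurable f (g zero)
    f₀ = ∩-measurable f (complement-measurable (g zero))

    split-each : ∀ i → P (F ∩ G (suc i)) ≈ P (F₁ ∩ G (suc i)) + P (F₀ ∩ G (suc i))
    split-each i = trans (P-split (G zero) h (g zero))
      (+-cong (P-cong (∩-measurable h (g zero)) (∩-measurable f₁ (g (suc i)))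
                (λ ω → swap (F ω) (G (suc i) ω) (G zero ω)))
              (P-cong (∩-measurable h (complement-measurable (g zero))) (∩-measurable f₀ (g (suc i)))
                (λ ω → swap (F ω) (G (suc i) ω) (not (G zero ω)))))
      where
      h = ∩-measurable f (g (suc i))
      swap : ∀ x y z → (x ∧ y) ∧ z ≡ (x ∧ z) ∧ y
      swap true  y z = ∧-comm y z
      swap false _ _ = ≡.refl

    rest : Ω → ℕ
    rest ω = ∣ tabulate (λ i → G (suc i) ω) ∣

    count-inside : ∀ ω → T (F₁ ω) → suc (rest ω) ℕ.≤ s
    count-inside ω t with F ω | G zero ω | count≤s ω
    ... | true | true | bound = bound tt

    count-outside : ∀ ω → T (F₀ ω) → rest ω ℕ.≤ s
    count-outside ω t with F ω | G zero ω | count≤s ω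
    ... | true | false | bound = bound tt

    inside : ∀ s → (∀ ω → T (F₁ ω) → suc (rest ω) ℕ.≤ s) →
      P F₁ + sum (λ i → P (F₁ ∩ G (suc i))) ≤ s · P F₁
    -- When s = 0 the event F₁ is empty.
    inside zero    none = begin
      P F₁ + sum (λ i → P (F₁ ∩ G (suc i)))
        ≤⟨ +-mono-≤ (P-mono f₁ ∅-measurable (λ ω t → contradiction (none ω t) λ ()))
                    (expected-count-bound (G ∘ suc) F₁ 0 (g ∘ suc) f₁
                      (λ ω t → contradiction (none ω t) λ ())) ⟩
      P ∅ + 0#  ≈⟨ +-identityʳ (P ∅) ⟩
      P ∅       ≈⟨ P-∅ ⟩
      0#        ∎
    inside (suc s) bound =
      +-monoʳ-≤ (P F₁) (expected-count-bound (G ∘ suc) F₁ s (g ∘ suc) f₁ (λ ω t → s≤s⁻¹ (bound ω t)))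

-- The hard pair of streams

-- Tokens are numbered 0, …, m.
lastToken : ∀ {m} → Fin (suc m)
lastToken {m} = Fin.fromℕ m

module HardStreams (ℛ : RealNumbers) where
  open RealNumbers ℛ hiding (sum)
  open OrderedField ℛ
  open ≤-Reasoning

  -- The vector with entry c at position ℓ and 0 elsewhere.
  single : ∀ {n} → ℝ → Fin n → Vector ℝ n
  single c ℓ i = if does (ℓ ≟ᶠ i) then c else 0#

  single-≡ : ∀ {n} c {ℓ i : Fin n} → ℓ ≡ i → single c ℓ i ≈ c
  single-≡ c {ℓ} {i} ℓ≡i rewrite dec-true (ℓ ≟ᶠ i) ℓ≡i = refl

  single-≢ : ∀ {n} c {ℓ i : Fin n} → ℓ ≢ i → single c ℓ i ≈ 0#
  single-≢ c {ℓ} {i} ℓ≢i rewrite dec-false (ℓ ≟ᶠ i) ℓ≢i = refl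

  0≤single : ∀ {n c} → 0# ≤ c → (ℓ i : Fin n) → 0# ≤ single c ℓ i
  0≤single 0≤c ℓ i with does (ℓ ≟ᶠ i)
  ... | true  = 0≤c
  ... | false = ≤-refl

  single≤0 : ∀ {n c} → c ≤ 0# → (ℓ i : Fin n) → single c ℓ i ≤ 0#
  single≤0 c≤0 ℓ i with does (ℓ ≟ᶠ i)
  ... | true  = c≤0
  ... | false = ≤-refl

  -- An injection p meets position ℓ at most once, so at most one term survives.
  sum-single : ∀ {m n} (p : Fin m → Fin n) → Injective _≡_ _≡_ p →
    ∀ c ℓ (f : Vector ℝ m) →
    ((∀ x → ℓ ≢ p x) × sum (λ x → f x * single c ℓ (p x)) ≈ 0#) ⊎
    (∃[ x ] ℓ ≡ p x × sum (λ x → f x * single c ℓ (p x)) ≈ f x * c)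
  sum-single {zero}  p p-inj c ℓ f = inj₁ ((λ ()) , refl)
  sum-single {suc m} p p-inj c ℓ f with ℓ ≟ᶠ p zero
  ... | yes ℓ≡p0 = inj₂ (zero , ℓ≡p0 , trans (+-congˡ (sum-zero others-vanish)) (+-identityʳ _))
    where
    others-vanish : ∀ x → f (suc x) * single c ℓ (p (suc x)) ≈ 0#
    others-vanish x = trans (*-congˡ (single-≢ c ℓ≢p)) (zeroʳ _)
      where
      ℓ≢p : ℓ ≢ p (suc x)
      ℓ≢p ℓ≡p with () ← p-inj (≡.trans (≡.sym ℓ≡p0) ℓ≡p)
  ... | no  ℓ≢p0 with sum-single (p ∘ suc) (suc-injective ∘ p-inj) c ℓ (f ∘ suc)
  ...   | inj₁ (ℓ∉p , sum≈0) =
    inj₁ ((λ { zero → ℓ≢p0 ; (suc x) → ℓ∉p x })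
         , trans (+-cong (zeroʳ (f zero)) sum≈0) (+-identityʳ 0#))
  ...   | inj₂ (x , ℓ≡px , sum≈fx*c) =
    inj₂ (suc x , ℓ≡px , trans (+-cong (zeroʳ (f zero)) sum≈fx*c) (+-identityˡ _))

  infix 8 _⋅_
  _⋅_ : ∀ {d} → Vector ℝ d → Vector ℝ d → ℝ
  _⋅_ = _∙_ ℛ

  -- Attention when the first value is +1 and, of all the other values, only the
  -- one with label ℓ (if present) is nonzero, namely -1. Attention is then the
  -- first weight, minus the weight of label ℓ if present, times the reciprocal r
  -- of the total weight w.
  attn-two-values : ∀ {m n d} (q : Vector ℝ d) (K V : Fin (suc m) → Vector ℝ d) j
    (ℓ : Fin n) (p : Fin m → Fin n) → Injective _≡_ _≡_ p →
    V zero j ≈ 1# → (∀ x → V (suc x) j ≈ single (- 1#) ℓ (p x)) →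
    ∃[ w ] ∃[ r ] 0# < w × w * r ≈ 1# ×
      (((∀ x → ℓ ≢ p x) × Attn ℛ q K V j ≈ exp (q ⋅ K zero) * r) ⊎
       (∃[ x ] ℓ ≡ p x × Attn ℛ q K V j ≈ (exp (q ⋅ K zero) - exp (q ⋅ K (suc x))) * r))
  attn-two-values {m} q K V j ℓ p p-inj V0≈1 V≈single =
    total , r , 0<total , proj₂ (inverse 0<total) , value
    where
    weight : Fin (suc m) → ℝ
    weight x = exp (q ⋅ K x)
    total = sum weight
    0<total = sum-pos weight (λ x → exp-pos (q ⋅ K x))
    r = proj₁ (inverse 0<total)

    later = sum (λ x → weight (suc x) * r * single (- 1#) ℓ (p x))
    Attn≈ : Attn ℛ q K V j ≈ weight zero * r + later
    Attn≈ = +-cong (trans (*-congˡ V0≈1) (*-identityʳ _))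
                   (sum-cong-≋ (λ x → *-congˡ (V≈single x)))

    value : ((∀ x → ℓ ≢ p x) × Attn ℛ q K V j ≈ weight zero * r) ⊎
            (∃[ x ] ℓ ≡ p x × Attn ℛ q K V j ≈ (weight zero - weight (suc x)) * r)
    value with sum-single p p-inj (- 1#) ℓ (λ x → weight (suc x) * r)
    ... | inj₁ (ℓ∉p , later≈0) = inj₁ (ℓ∉p , trans Attn≈ (trans (+-congˡ later≈0) (+-identityʳ _)))
    ... | inj₂ (x , ℓ≡px , later≈) = inj₂ (x , ℓ≡px , (begin-equality
      Attn ℛ q K V j                            ≈⟨ Attn≈ ⟩
      weight zero * r + later                   ≈⟨ +-congˡ later≈ ⟩
      weight zero * r + weight (suc x) * r * - 1#
        ≈⟨ +-congˡ (trans (sym (-‿distribʳ-* _ 1#)) (-‿cong (*-identityʳ _))) ⟩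
      weight zero * r - weight (suc x) * r      ≈⟨ [y-z]x≈yx-zx r _ _ ⟨
      (weight zero - weight (suc x)) * r        ∎))

  single-⋅ : ∀ {d} s (y : Vector ℝ (suc d)) → single s zero ⋅ y ≈ s * y zero
  single-⋅ s y = trans (+-congˡ (sum-zero (λ j → zeroˡ (y (suc j))))) (+-identityʳ _)

  -- The targets 0 and δ / w > 0 have no common approximation. In y₁ ≤ η y₁ the
  -- denominator w is cleared to reach δ ≤ η δ, which is absurd for η < 1.
  no-common-approximation : ∀ {η o y₀ y₁ δ w r} → η < 1# →
    y₀ ≈ 0# → y₁ ≈ δ * r → 0# < w → w * r ≈ 1# → 0# < δ →
    o - y₀ ≤ η * y₀ → y₁ - o ≤ η * y₁ → ⊥
  no-common-approximation {η} {o} {y₀} {y₁} {δ} {w} {r} η<1 y₀≈0 y₁≈δr 0<w wr≈1 0<δ o≤ y₁≤ =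
    δ≤ηδ (begin-strict
      η * δ   <⟨ *-monoˡ-< 0<δ η<1 ⟩
      1# * δ  ≈⟨ *-identityˡ δ ⟩
      δ       ∎)
    where
    o≤0 : o ≤ 0#
    o≤0 = begin
      o             ≈⟨ x-y+y≈x y₀ o ⟨
      o - y₀ + y₀   ≤⟨ +-monoˡ-≤ y₀ o≤ ⟩
      η * y₀ + y₀   ≈⟨ +-cong (trans (*-congˡ y₀≈0) (zeroʳ η)) y₀≈0 ⟩
      0# + 0#       ≈⟨ +-identityʳ 0# ⟩
      0#            ∎
    y₁≤ηy₁ : y₁ ≤ η * y₁
    y₁≤ηy₁ = begin
      y₁           ≈⟨ x-y+y≈x o y₁ ⟨
      y₁ - o + o   ≤⟨ +-mono-≤ y₁≤ o≤0 ⟩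
      η * y₁ + 0#  ≈⟨ +-identityʳ _ ⟩
      η * y₁       ∎
    y₁w≈δ : y₁ * w ≈ δ
    y₁w≈δ = begin-equality
      y₁ * w       ≈⟨ *-congʳ y₁≈δr ⟩
      δ * r * w    ≈⟨ *-assoc δ r w ⟩
      δ * (r * w)  ≈⟨ *-congˡ (trans (*-comm r w) wr≈1) ⟩
      δ * 1#       ≈⟨ *-identityʳ δ ⟩
      δ            ∎
    δ≤ηδ : δ ≤ η * δ
    δ≤ηδ = begin
      δ             ≈⟨ y₁w≈δ ⟨
      y₁ * w        ≤⟨ *-monoˡ-≤ (<⇒≤ 0<w) y₁≤ηy₁ ⟩
      η * y₁ * w    ≈⟨ *-assoc η y₁ w ⟩
      η * (y₁ * w)  ≈⟨ *-congˡ y₁w≈δ ⟩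
      η * δ         ∎

  -- The stream of a token suc ℓ and a real c. All queries vanish but the last,
  -- which reads the first coordinate of the keys; all keys vanish but that of
  -- token suc ℓ, all of whose coordinates are -c; all coordinates of the values
  -- are +1 at token 0, -1 at token suc ℓ and 0 elsewhere. So c affects the score
  -- of the last query with key suc ℓ, and no other. Token 0 comes before suc ℓ,
  -- which keeps the earlier targets nonnegative. The pair of streams is given by
  -- c = 0 and c = 1.
  module _ {m d : ℕ} (ℓ : Fin m) where

    key : ℝ → Fin (suc m) → ℝ
    key c zero    = 0#
    key c (suc y) = single (- c) ℓ y

    hard : ℝ → Stream ℛ (suc m) (suc d)
    hard c = record
      { q = λ a → single (single 1# lastToken a) zero
      ; k = λ y _ → key c y
      ; v = λ { zero _ → 1# ; (suc y) _ → single (- 1#) ℓ y }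
      }

    private
      module Hard (c : ℝ) = Stream (hard c)
      open Hard using (q; k; v; score)

    score≈ : ∀ c a y → score c a y ≈ single 1# lastToken a * key c y
    score≈ c a y = single-⋅ (single 1# lastToken a) (k c y)

    score-zero : ∀ c a → score c a zero ≈ 0#
    score-zero c a = trans (score≈ c a zero) (zeroʳ _)

    score-critical : ∀ c → score c lastToken (suc ℓ) ≈ - c
    score-critical c = begin-equality
      score c lastToken (suc ℓ)                     ≈⟨ score≈ c (lastToken {m}) (suc ℓ) ⟩
      single 1# (lastToken {m}) lastToken * single (- c) ℓ ℓ
        ≈⟨ *-cong (single-≡ 1# {lastToken {m}} ≡.refl) (single-≡ (- c) {ℓ} ≡.refl) ⟩
      1# * - c                                 ≈⟨ *-identityˡ (- c) ⟩
      - c                                      ∎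

    -0≤ : ∀ {c} → 0# ≤ c → - c ≤ 0#
    -0≤ {c} 0≤c = begin
      - c       ≈⟨ +-identityˡ (- c) ⟨
      0# - c    ≤⟨ +-monoˡ-≤ (- c) 0≤c ⟩
      c - c     ≈⟨ -‿inverseʳ c ⟩
      0#        ∎

    score≤score-zero : ∀ {c} → 0# ≤ c → ∀ a y → score c a (suc y) ≤ score c a zero
    score≤score-zero {c} 0≤c a y = begin
      score c a (suc y)                        ≈⟨ score≈ c a (suc y) ⟩
      single 1# lastToken a * single (- c) ℓ y      ≈⟨ *-comm _ _ ⟩
      single (- c) ℓ y * single 1# lastToken a      ≤⟨ *-monoˡ-≤ (0≤single (<⇒≤ 0<1) lastToken a) (single≤0 (-0≤ 0≤c) ℓ y) ⟩
      0# * single 1# lastToken a                    ≈⟨ zeroˡ _ ⟩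
      0#                                       ≈⟨ score-zero c a ⟨
      score c a zero                           ∎

    -- Away from the critical entry the scores do not depend on c.
    score-agree : ∀ c c′ a y → ¬ (a ≡ lastToken × y ≡ suc ℓ) → score c a y ≈ score c′ a y
    score-agree c c′ a zero    _    = trans (score-zero c a) (sym (score-zero c′ a))
    score-agree c c′ a (suc y) away = trans (vanish c) (sym (vanish c′))
      where
      factor-vanishes : ∀ c → Dec (lastToken ≡ a) → Dec (ℓ ≡ y) →
        single 1# lastToken a * single (- c) ℓ y ≈ 0#
      factor-vanishes c (yes last≡a) (yes ℓ≡y) =
        contradiction (≡.sym last≡a , ≡.cong suc (≡.sym ℓ≡y)) away
      factor-vanishes c (no last≢a)  _         = trans (*-congʳ (single-≢ 1# last≢a)) (zeroˡ _)
      factor-vanishes c (yes _)      (no ℓ≢y)  = trans (*-congˡ (single-≢ (- c) ℓ≢y)) (zeroʳ _)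
      vanish : ∀ c → score c a (suc y) ≈ 0#
      vanish c = trans (score≈ c a (suc y)) (factor-vanishes c (lastToken ≟ᶠ a) (ℓ ≟ᶠ y))

    -- In the i-th prefix, row suc x belongs to token suc (label i x).
    label : (i : Fin (suc m)) → Fin (toℕ i) → Fin m
    label i x = inject≤ x (s≤s⁻¹ (toℕ<n i))

    -- The two cases: token suc ℓ has not arrived yet, or it has.
    target : ∀ c i j →
      ∃[ w ] ∃[ r ] 0# < w × w * r ≈ 1# ×
        (((∀ x → ℓ ≢ label i x) × Target ℛ (hard c) i j ≈ exp (score c i zero) * r) ⊎
         (∃[ x ] ℓ ≡ label i x ×
            Target ℛ (hard c) i j ≈ (exp (score c i zero) - exp (score c i (suc (label i x)))) * r))
    target c i j = attn-two-values (q c i) (prefix ℛ i (k c)) (prefix ℛ i (v c)) j ℓ (label i)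
      (inject≤-injective _ _ _ _) refl (λ _ → refl)

    hard-admissible : ∀ {c} → 0# ≤ c → Admissible ℛ (hard c)
    hard-admissible {c} 0≤c i j with target c i j
    ... | w , r , 0<w , wr≈1 , inj₁ (_ , Target≈) =
      ≤-trans (*-nonneg (<⇒≤ (exp-pos _)) (reciprocal-nonneg 0<w wr≈1)) (≤-reflexive (sym Target≈))
    ... | w , r , 0<w , wr≈1 , inj₂ (x , _ , Target≈) =
      ≤-trans (*-nonneg (x≤y⇒0≤y-x (exp-mono-≤ (score≤score-zero 0≤c i (label i x))))
                        (reciprocal-nonneg 0<w wr≈1))
              (≤-reflexive (sym Target≈))

    target-last : ∀ c j → ∃[ w ] ∃[ r ] 0# < w × w * r ≈ 1# ×
      Target ℛ (hard c) lastToken j ≈ (exp 0# - exp (- c)) * r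
    target-last c j with target c lastToken j
    ... | w , r , 0<w , wr≈1 , inj₁ (ℓ∉label , _) = contradiction (≡.sym label-y≡ℓ) (ℓ∉label y)
      where
      ℓ<last : toℕ ℓ ℕ.< toℕ (lastToken {m})
      ℓ<last = ≡.subst (toℕ ℓ ℕ.<_) (≡.sym (toℕ-fromℕ m)) (toℕ<n ℓ)
      y = Fin.fromℕ< ℓ<last
      label-y≡ℓ : label lastToken y ≡ ℓ
      label-y≡ℓ = toℕ-injective (≡.trans (toℕ-inject≤ y _) (toℕ-fromℕ< ℓ<last))
    ... | w , r , 0<w , wr≈1 , inj₂ (x , ℓ≡label , Target≈) =
      w , r , 0<w , wr≈1 , trans Target≈ (*-congʳ (+-cong (exp-cong (score-zero c lastToken))
        (-‿cong (exp-cong (trans (reflexive (≡.cong (score c lastToken ∘ suc) (≡.sym ℓ≡label)))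
                                 (score-critical c))))))

-- Accesses of an accurate algorithm

module AccessesOfAccurateAlgorithms (ℛ : RealNumbers) where
  open RealNumbers ℛ hiding (sum)
  open OrderedField ℛ
  open HardStreams ℛ

  module _ {τ : ℕ → ℕ} {m d : ℕ} (A : NonAdaptiveAlgorithm ℛ τ (suc m) (suc d))
           {η : ℝ} (η<1 : η < 1#) (accurate : NonAdaptiveAlgorithm.OutputsApproximations A η) where
    open NonAdaptiveAlgorithm A
    open Probability ℛ randomness
    open ≤-Reasoning

    -- The seeds for which the score of the last query with key suc ℓ is accessed.
    Accessed : Fin m → Event
    Accessed ℓ ω = lookup (accesses ω lastToken) (suc ℓ)

    -- A seed that is accurate on both streams of the pair must access the only
    -- entry that tells them apart.
    accurate⇒accessed : ∀ ℓ ω →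
      (∀ i → Approximates ℛ η (output ω (hard ℓ 0#) i) (Target ℛ (hard ℓ 0#) i)) →
      (∀ i → Approximates ℛ η (output ω (hard ℓ 1#) i) (Target ℛ (hard ℓ 1#) i)) →
      T (Accessed ℓ ω)
    accurate⇒accessed ℓ ω approx₀ approx₁ with T? (Accessed ℓ ω)
    ... | yes accessed = accessed
    ... | no  unread   = contradiction
      (≤-trans (≤-reflexive (+-congʳ (sym same-output))) (proj₁ (approx₀ lastToken zero)))
      (λ o≤ → no-common-approximation η<1 target₀≈0 target₁≈ 0<w wr≈1 0<δ o≤
                (proj₂ (approx₁ lastToken zero)))
      where
      same-output : output ω (hard ℓ 0#) lastToken zero ≈ output ω (hard ℓ 1#) lastToken zero
      same-output = output-local ω lastToken (hard ℓ 0#) (hard ℓ 1#)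
        (λ _ _ _ → refl) (λ _ _ _ → refl)
        (λ a y _ _ y∈accesses → score-agree {d = d} ℓ 0# 1# a y
          λ { (≡.refl , ≡.refl) → unread (≡.subst T (≡.sym ([]=⇒lookup y∈accesses)) tt) })
        zero

      target₀≈0 : Target ℛ (hard {d = d} ℓ 0#) lastToken zero ≈ 0#
      target₀≈0 with target-last {d = d} ℓ 0# zero
      ... | _ , r , _ , _ , Target≈ = begin-equality
        Target ℛ (hard {d = d} ℓ 0#) lastToken zero  ≈⟨ Target≈ ⟩
        (exp 0# - exp (- 0#)) * r    ≈⟨ *-congʳ (+-congˡ (-‿cong (exp-cong -0#≈0#))) ⟩
        (exp 0# - exp 0#) * r        ≈⟨ *-congʳ (-‿inverseʳ (exp 0#)) ⟩
        0# * r                       ≈⟨ zeroˡ r ⟩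
        0#                           ∎

      target₁ = target-last {d = d} ℓ 1# zero
      0<w      = proj₁ (proj₂ (proj₂ target₁))
      wr≈1     = proj₁ (proj₂ (proj₂ (proj₂ target₁)))
      target₁≈ = proj₂ (proj₂ (proj₂ (proj₂ target₁)))

      0<δ : 0# < exp 0# - exp (- 1#)
      0<δ = x<y⇒0<y-x (exp-mono-< (begin-strict
        - 1#       ≈⟨ +-identityˡ (- 1#) ⟨
        0# - 1#    <⟨ +-monoˡ-< (- 1#) 0<1 ⟩
        1# - 1#    ≈⟨ -‿inverseʳ 1# ⟩
        0#         ∎))

    Accessed-measurable : ∀ ℓ → Measurable (Accessed ℓ)
    Accessed-measurable ℓ = accesses-measurable lastToken (suc ℓ)

    -- The probability is even at least 8/10, as 9/10 + 9/10 - 1; the bound 1/2 is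
    -- all that is used. F stands for an event of probability 1.
    access-probability : ∀ {F} → Measurable F → 1# ≤ P F → ∀ ℓ →
      1# ≤ P (F ∩ Accessed ℓ) + P (F ∩ Accessed ℓ)
    access-probability {F} f 1≤PF ℓ
      with accurate (hard ℓ 0#) (hard-admissible ℓ ≤-refl)
         | accurate (hard ℓ 1#) (hard-admissible ℓ (<⇒≤ 0<1))
    ... | E₀ , e₀ , p≤PE₀ , E₀⊆ | E₁ , e₁ , p≤PE₁ , E₁⊆ = begin
      1#         ≈⟨ proj₂ tenth ⟨
      fromℕ 10 * u  ≈⟨ fromℕ* 10 ⟩
      10 · u     ≤⟨ 10u≤16u ⟩
      16 · u     ≈⟨ ×-homo-+ u 8 8 ⟩
      8 · u + 8 · u  ≤⟨ +-mono-≤ 8u≤p 8u≤p ⟩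
      p + p      ∎
      where
      G = Accessed ℓ
      g = Accessed-measurable ℓ
      p = P (F ∩ G)
      tenth = inverse (fromℕ-pos 9)
      u = proj₁ tenth

      fromℕ* : ∀ n → fromℕ n * u ≈ n · u
      fromℕ* n = trans (×-assoc-* n 1# u) (×-congʳ n (*-identityˡ u))

      10u≤16u : 10 · u ≤ 16 · u
      10u≤16u = begin
        10 · u           ≈⟨ +-identityʳ _ ⟨
        10 · u + 0#      ≤⟨ +-monoʳ-≤ _ (·-nonneg 6 (reciprocal-nonneg (fromℕ-pos 9) (proj₂ tenth))) ⟩
        10 · u + 6 · u   ≈⟨ ×-homo-+ u 10 6 ⟨
        16 · u           ∎

      PG≤p : P G ≤ p
      PG≤p = +-cancelʳ-≤ 1# (begin
        P G + 1#     ≤⟨ +-monoʳ-≤ (P G) 1≤PF ⟩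
        P G + P F    ≈⟨ +-comm (P G) (P F) ⟩
        P F + P G    ≤⟨ P-∩-lower-bound f g ⟩
        p + 1#       ∎)

      E₀∩E₁⊆G : ∀ ω → T ((E₀ ∩ E₁) ω) → T (G ω)
      E₀∩E₁⊆G ω t =
        let t₀ , t₁ = Equivalence.to (T-∧ {E₀ ω}) t
        in accurate⇒accessed ℓ ω (E₀⊆ ω t₀) (E₁⊆ ω t₁)

      8u≤p : 8 · u ≤ p
      8u≤p = +-cancelʳ-≤ (10 · u) (begin
        8 · u + 10 · u               ≈⟨ ×-homo-+ u 8 10 ⟨
        18 · u                       ≈⟨ ×-homo-+ u 9 9 ⟩
        9 · u + 9 · u                ≈⟨ +-cong (fromℕ* 9) (fromℕ* 9) ⟨
        nine-tenths ℛ + nine-tenths ℛ  ≤⟨ +-mono-≤ p≤PE₀ p≤PE₁ ⟩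
        P E₀ + P E₁                  ≤⟨ P-∩-lower-bound e₀ e₁ ⟩
        P (E₀ ∩ E₁) + 1#             ≤⟨ +-monoˡ-≤ 1# (P-mono (∩-measurable e₀ e₁) g E₀∩E₁⊆G) ⟩
        P G + 1#                     ≤⟨ +-monoˡ-≤ 1# PG≤p ⟩
        p + 1#                       ≈⟨ +-congˡ (trans (sym (proj₂ tenth)) (fromℕ* 10)) ⟩
        p + 10 · u                   ∎)

    -- If at most s entries of the last row are accessed almost surely, then
    -- m / 2 ≤ E[#accesses] ≤ s.
    number-of-accesses : ∀ s → AlmostSurely (λ ω → ∣ accesses ω lastToken ∣ ℕ.≤ s) → m ℕ.≤ s ℕ.+ s
    number-of-accesses s (F , f , 1≤PF , few) = fromℕ-cancel-≤ (begin
      fromℕ m                            ≈⟨ sum-replicate m ⟨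
      sum {m} (λ _ → 1#)                 ≤⟨ sum-mono-≤ (access-probability f 1≤PF) ⟩
      sum (λ ℓ → p ℓ + p ℓ)              ≈⟨ ∑-distrib-+ p p ⟩
      sum p + sum p                      ≤⟨ +-mono-≤ sum-p≤s sum-p≤s ⟩
      fromℕ s + fromℕ s                  ≈⟨ ×-homo-+ 1# s s ⟨
      fromℕ (s ℕ.+ s)                    ∎)
      where
      p : Fin m → ℝ
      p ℓ = P (F ∩ Accessed ℓ)

      count-tail : (S : Subset (suc m)) → ∣ tabulate (λ ℓ → lookup S (suc ℓ)) ∣ ℕ.≤ ∣ S ∣
      count-tail (b ∷ S) rewrite tabulate∘lookup S with b
      ... | true  = ℕ.n≤1+n ∣ S ∣
      ... | false = ℕ.≤-refl

      sum-p≤s : sum p ≤ fromℕ s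
      sum-p≤s = begin
        sum p    ≤⟨ expected-count-bound Accessed F s Accessed-measurable f
                      (λ ω t → ℕ.≤-trans (count-tail (accesses ω lastToken)) (few ω t)) ⟩
        s · P F  ≤⟨ ·-mono-≤ s (P≤1 f) ⟩
        fromℕ s  ∎

  module _ {τ : ℕ → ℕ} {m d : ℕ} (A : NonAdaptiveAlgorithm ℛ τ (suc m) (suc d))
           {η : ℝ} (η<1 : η < 1#) (accurate : NonAdaptiveAlgorithm.OutputsApproximations A η) where
    open NonAdaptiveAlgorithm A
    open ℕ.≤-Reasoning

    -- The dimension is d + 1. One access takes time τ ≥ (d + 1) / a > 0, so at most
    -- t / τ accesses to the last row fit into the time t.
    time-bound : ∀ a → suc d ℕ.≤ a ℕ.* τ (suc d) → ∀ t → LastTokenTimeBound t →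
      1 ℕ.≤ m → suc m ℕ.* suc d ℕ.≤ 4 ℕ.* a ℕ.* t
    time-bound a d≤aτ t bound 1≤m = go (τ (suc d)) ≡.refl
      where
      go : ∀ k → k ≡ τ (suc d) → suc m ℕ.* suc d ℕ.≤ 4 ℕ.* a ℕ.* t
      -- τ = 0 would force d + 1 ≤ 0.
      go zero    0≡τ = contradiction
        (ℕ.≤-trans d≤aτ (ℕ.≤-reflexive (≡.trans (≡.cong (a ℕ.*_) (≡.sym 0≡τ)) (ℕ.*-zeroʳ a)))) λ ()
      go (suc k) τ≡  = begin
        suc m ℕ.* suc d                    ≤⟨ ℕ.*-mono-≤ n≤4s d≤aτ ⟩
        4 ℕ.* s ℕ.* (a ℕ.* τ (suc d))      ≡⟨ ≡.cong (λ x → 4 ℕ.* s ℕ.* (a ℕ.* x)) τ≡ ⟨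
        4 ℕ.* s ℕ.* (a ℕ.* suc k)          ≡⟨ ℕ.[m*n]*[o*p]≡[m*o]*[n*p] 4 s a (suc k) ⟩
        4 ℕ.* a ℕ.* (s ℕ.* suc k)          ≤⟨ ℕ.*-monoʳ-≤ (4 ℕ.* a) (ℕ.m/n*n≤m t (suc k)) ⟩
        4 ℕ.* a ℕ.* t                      ∎
        where
        s = t ℕ./ suc k

        few-accesses : AlmostSurely (λ ω → ∣ accesses ω lastToken ∣ ℕ.≤ s)
        -- The accesses do not depend on the stream, so any stream will do.
        few-accesses with bound (record { q = λ _ _ → 0# ; k = λ _ _ → 0# ; v = λ _ _ → 0# })
        ... | F , f , 1≤PF , fast = F , f , 1≤PF , λ ω t∈F → few ω (fast ω t∈F)
          where
          few : ∀ ω {σ} → lastTokenTime ω σ ℕ.≤ t → ∣ accesses ω lastToken ∣ ℕ.≤ s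
          few ω {σ} time≤t = begin
            accessed                              ≡⟨ ℕ.m*n/n≡m accessed (suc k) ⟨
            accessed ℕ.* suc k ℕ./ suc k          ≤⟨ ℕ./-monoˡ-≤ (suc k) accesses≤t ⟩
            s                                     ∎
            where
            accessed = ∣ accesses ω lastToken ∣
            accesses≤t : accessed ℕ.* suc k ℕ.≤ t
            accesses≤t = begin
              accessed ℕ.* suc k          ≡⟨ ≡.cong (accessed ℕ.*_) τ≡ ⟩
              accessed ℕ.* τ (suc d)      ≤⟨ access-time ω σ lastToken (≡.cong suc (toℕ-fromℕ m)) ⟩
              lastTokenTime ω σ           ≤⟨ time≤t ⟩
              t                           ∎

        n≤4s : suc m ℕ.≤ 4 ℕ.* s
        n≤4s = begin
          suc m                          ≤⟨ ℕ.+-monoˡ-≤ m 1≤m ⟩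
          m ℕ.+ m                        ≤⟨ ℕ.+-mono-≤ m≤2s m≤2s ⟩
          (s ℕ.+ s) ℕ.+ (s ℕ.+ s)        ≡⟨ four-times ⟩
          4 ℕ.* s                        ∎
          where
          m≤2s = number-of-accesses A η<1 accurate s few-accesses
          four-times : (s ℕ.+ s) ℕ.+ (s ℕ.+ s) ≡ 4 ℕ.* s
          four-times = ≡.trans (ℕ.+-assoc s s (s ℕ.+ s))
            (≡.cong (λ x → s ℕ.+ (s ℕ.+ (s ℕ.+ x))) (≡.sym (ℕ.+-identityʳ s)))

open import Data.Nat using (_≤_; _*_)

theorem2 : (ℛ : RealNumbers) (queryTime : ℕ → ℕ) → Θ-linear queryTime →
    (η : RealNumbers.ℝ ℛ) →
    RealNumbers._<_ ℛ (RealNumbers.0# ℛ) η →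
    RealNumbers._<_ ℛ η (RealNumbers.1# ℛ) →
    ∃[ C ] ∃[ n₀ ] ∀ (n d : ℕ) → n₀ ≤ n →
    (A : NonAdaptiveAlgorithm ℛ queryTime n d) →
    NonAdaptiveAlgorithm.OutputsApproximations A η →
    ∀ (t : ℕ) → NonAdaptiveAlgorithm.LastTokenTimeBound A t →
    n * d ≤ C * t
theorem2 ℛ queryTime (a , _ , linear) η 0<η η<1 = 4 * a , 2 , lower-bound
  where
  lower-bound : ∀ (n d : ℕ) → 2 ≤ n →
    (A : NonAdaptiveAlgorithm ℛ queryTime n d) →
    NonAdaptiveAlgorithm.OutputsApproximations A η →
    ∀ (t : ℕ) → NonAdaptiveAlgorithm.LastTokenTimeBound A t →
    n * d ≤ 4 * a * t
  lower-bound n       zero    _         A accurate t bound =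
    ℕ.≤-trans (ℕ.≤-reflexive (ℕ.*-zeroʳ n)) ℕ.z≤n
  lower-bound (suc m) (suc d) (s≤s 1≤m) A accurate t bound =
    AccessesOfAccurateAlgorithms.time-bound ℛ A η<1 accurate a (proj₁ (linear (suc d) (s≤s ℕ.z≤n))) t bound 1≤m
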